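{- Up to renaming of variables, the only minimally avoidable formula with exactly one fragment is $AA$.
   Context: Variables are letters of an alphabet $\Delta=\{A,B,C,\dots\}$. A formula is a finite set of non-empty words over $\Delta$, called fragments, written separated by dots; by convention every variable of a formula occurs at least twice in total (no isolated variable) and no fragment is a factor of another fragment. An occurrence of a formula $f$ in a word $w$ over an alphabet $\Sigma$ is a non-erasing morphism $h:\Delta^*\to\Sigma^*$ such that $h(\phi)$ is a factor of $w$ for every fragment $\phi$; $f$ is avoidable if for some finite alphabet there is an infinite word containing no occurrence of $f$, and unavoidable otherwise. Splitting a formula on a fragment $\phi$ means replacing $\phi$ by two fragments, namely the prefix and the suffix of $\phi$ of length $|\phi|-1$. A formula is minimally avoidable if it is avoidable and splitting it on any of its fragments yields an unavoidable formula. -}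

module Defs where

open import Data.Nat using (ℕ; _+_; _<_; _≤_; _∸_; _≟_)
open import Data.Fin using (Fin; fromℕ<)
open import Data.List using (List; []; _∷_; length; lookup; concatMap; take; drop; removeAt; filter; _++_)
open import Data.List.Relation.Unary.All using (All)
open import Data.List.Membership.Propositional using (_∈_)
open import Data.Product using (Σ; ∃; _×_)
open import Relation.Binary.PropositionalEquality using (_≡_; _≢_)
open import Relation.Nullary using (¬_)

Var : Set
Var = ℕ

Word : Set
Word = List Var

Formula : Set
Formula = List Word

InfWord : ℕ → Set
InfWord k = ℕ → Fin k

Factor : {k : ℕ} → List (Fin k) → InfWord k → Set
Factor u w = ∃ λ i → (j : ℕ) (p : j < length u) → w (i + j) ≡ lookup u (fromℕ< p)

-- A morphism Δ* → (Fin k)* is determined by images of the variables.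
Morphism : ℕ → Set
Morphism k = Var → List (Fin k)

NonErasing : {k : ℕ} → Morphism k → Set
NonErasing h = ∀ x → h x ≢ []

apply : {k : ℕ} → Morphism k → Word → List (Fin k)
apply h φ = concatMap h φ

Occurs : {k : ℕ} → Formula → InfWord k → Set
Occurs {k} f w = Σ (Morphism k) λ h → NonErasing h × All (λ φ → Factor (apply h φ) w) f

Avoidable : Formula → Set
Avoidable f = ∃ λ k → Σ (InfWord k) λ w → ¬ Occurs f w

Unavoidable : Formula → Set
Unavoidable f = ¬ Avoidable f

splitAt : (f : Formula) → Fin (length f) → Formula
splitAt f i = removeAt f i ++ (take (length φ ∸ 1) φ ∷ drop 1 φ ∷ [])
  where φ = lookup f i

MinimallyAvoidable : Formula → Set
MinimallyAvoidable f = Avoidable f × ((i : Fin (length f)) → Unavoidable (splitAt f i))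

occ : Var → Word → ℕ
occ x φ = length (filter (x ≟_) φ)

-- The one-fragment formula [ φ ] satisfies the conventions: φ is non-empty and
-- every variable of φ occurs at least twice (the no-factor condition is vacuous).
IsOneFragmentFormula : Word → Set
IsOneFragmentFormula φ = φ ≢ [] × (∀ x → x ∈ φ → 2 ≤ occ x φ)

{-# OPTIONS --safe #-}

-- For every c there is an infinite word over a finite alphabet in which two
-- occurrences of a factor of length m ≥ 1 are always more than c m apart. Let h
-- be an occurrence in it of a formula f each of whose variables occurs twice in
-- some fragment, and let x be a variable of f with h x longest. Two copies of
-- h x in the image of a fragment are at most |f| |h x| apart, so the word for
-- c = |f| avoids f. In particular AA is avoidable. If φ = A ψ B is longer than
-- AA, then either A = B does not occur in ψ, and the formula ψ is of this kind,
-- or the formula Aψ.ψB is; in both cases Aψ.ψB is avoidable.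
module Submission where

open import Defs
open import Data.List using (List; []; _∷_)
open import Data.Product using (∃; _×_)
open import Relation.Binary.PropositionalEquality using (_≡_)

open import Data.Fin using (Fin; zero; suc; toℕ; fromℕ<; combine)
open import Data.Fin.Properties using (toℕ-fromℕ<; combine-injectiveˡ; combine-injectiveʳ)
open import Data.List using (length; lookup; filter; concat; take; initLast; _∷ʳ′_; _++_; [_])
open import Data.List.Extrema.Nat using (argmax; argmax-sel; f[xs]≤f[argmax])
open import Data.List.Membership.Propositional using (_∈_; _∉_; find)
open import Data.List.Membership.DecPropositional using (_∈?_)
open import Data.List.Membership.Propositional.Properties using (∈-∃++; ∈-concat⁺′; ∈-++⁺ˡ; ∈-++⁻)
open import Data.List.Properties using (length-++; length-++-≤ˡ; length-++-≤ʳ; concatMap-++; filter-++; filter-some; filter-accept; filter-reject)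
open import Data.List.Relation.Unary.All as All using (All; []; _∷_)
open import Data.List.Relation.Unary.All.Properties using (++⁻ˡ; ++⁻ʳ)
open import Data.List.Relation.Unary.Any using (Any; here; there)
open import Data.Nat using (ℕ; zero; suc; _+_; _*_; _≤_; _<_; _≟_; z≤n; s≤s; s≤s⁻¹; NonZero; NonTrivial; nonTrivial⇒nonZero; nonTrivial⇒n>1; nonTrivial⇒≢1)
open import Data.Nat.DivMod using (_/_; _%_; _mod_; m%n<n; m≡m%n+[m/n]*n; m/n*n≤m; m*n/n≡m; m/n<m)
open import Data.Nat.Divisibility using (_∣_; _∣?_; divides; n∣m*n; ∣m+n∣m⇒∣n; *-cancelʳ-∣; ∣1⇒≡1)
open import Data.Nat.Induction using (Acc; acc; <-wellFounded)
open import Data.Nat.Properties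
open import Data.Nat.Tactic.RingSolver using (solve-∀)
open import Data.Product using (Σ; _,_; proj₁; proj₂; ∃₂)
open import Data.Sum using (inj₁; inj₂)
open import Data.Unit using (⊤; tt)
open import Function using (_∘_)
open import Relation.Binary.PropositionalEquality using (_≢_; refl; sym; trans; cong; subst; module ≡-Reasoning)
open import Relation.Nullary using (¬_; yes; no; contradiction)

Repeats : {A : Set} → (ℕ → A) → (i m d : ℕ) → Set
Repeats w i m d = ∀ n → i ≤ n → n < i + m → w n ≡ w (n + d)

-- Words with widely spaced repetitions

mod≡⇒∣ : ∀ b .{{_ : NonZero b}} n d → n mod b ≡ (n + d) mod b → b ∣ d
mod≡⇒∣ b n d eq = ∣m+n∣m⇒∣n (divides ((n + d) / b) quotients) (n∣m*n (n / b))
  where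
  remainders : n % b ≡ (n + d) % b
  remainders = trans (sym (toℕ-fromℕ< (m%n<n n b)))
    (trans (cong toℕ eq) (toℕ-fromℕ< (m%n<n (n + d) b)))

  open ≡-Reasoning
  quotients : n / b * b + d ≡ (n + d) / b * b
  quotients = +-cancelˡ-≡ (n % b) _ _ (begin
    n % b + (n / b * b + d)            ≡⟨ +-assoc (n % b) (n / b * b) d ⟨
    n % b + n / b * b + d              ≡⟨ cong (_+ d) (m≡m%n+[m/n]*n n b) ⟨
    n + d                              ≡⟨ m≡m%n+[m/n]*n (n + d) b ⟩
    (n + d) % b + (n + d) / b * b      ≡⟨ cong (_+ (n + d) / b * b) remainders ⟨
    n % b + (n + d) / b * b            ∎)

-- Rounding up puts the multiple at or after the start `i` of a window; `digits-coarsen` begins its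
-- window of quotients there.
ceiling : ∀ b .{{_ : NonZero b}} i → ∃ λ q → i ≤ q * b × q * b < i + b
ceiling b i with i % b in eq
... | zero  = i / b , ≤-reflexive i≡ , subst (_< i + b) i≡ (m<m+n i (≤-<-trans z≤n (m%n<n i b)))
  where
  i≡ : i ≡ i / b * b
  i≡ = trans (m≡m%n+[m/n]*n i b) (cong (_+ i / b * b) eq)
... | suc r = suc (i / b) , below , above
  where
  open ≤-Reasoning
  i≡ : i ≡ suc r + i / b * b
  i≡ = trans (m≡m%n+[m/n]*n i b) (cong (_+ i / b * b) eq)

  below : i ≤ b + i / b * b
  below = begin
    i                  ≡⟨ m≡m%n+[m/n]*n i b ⟩
    i % b + i / b * b  ≤⟨ +-monoˡ-≤ (i / b * b) (<⇒≤ (m%n<n i b)) ⟩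
    b + i / b * b      ∎

  above : b + i / b * b < i + b
  above = begin-strict
    b + i / b * b          ≡⟨ +-comm b (i / b * b) ⟩
    i / b * b + b          <⟨ +-monoˡ-< b (m<n+m (i / b * b) (s≤s z≤n)) ⟩
    suc r + i / b * b + b  ≡⟨ cong (_+ b) i≡ ⟨
    i + b                  ∎

module Toeplitz (b : ℕ) .{{nt : NonTrivial b}} where

  instance
    b≢0 : NonZero b
    b≢0 = nonTrivial⇒nonZero b

    b²≢0 : NonZero (b * b)
    b²≢0 = m*n≢0 b b

  -- The first argument is fuel for the repeated division by `b`. As `b ≥ 2`, fuel `n` is enough for
  -- `n`, and any larger amount gives the same value.
  digits′ : ℕ → ℕ → Fin (b * b)
  digits′ zero    n = n mod (b * b)
  digits′ (suc k) n with b ∣? n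
  ... | yes _ = digits′ k (n / b)
  ... | no  _ = n mod (b * b)

  -- The last two base-b digits of n after removal of its trailing zeros.
  -- The value at 0 is 0.
  digits : ℕ → Fin (b * b)
  digits n = digits′ n n

  digits′-0 : ∀ k → digits′ k 0 ≡ 0 mod (b * b)
  digits′-0 zero = refl
  digits′-0 (suc k) with b ∣? 0
  ... | yes _ = trans (cong (digits′ k) (m*n/n≡m 0 b)) (digits′-0 k)
  ... | no  _ = refl

  digits′-fuel : ∀ k l n → n ≤ k → n ≤ l → digits′ k n ≡ digits′ l n
  digits′-fuel k l zero _ _ = trans (digits′-0 k) (sym (digits′-0 l))
  digits′-fuel (suc k) (suc l) n@(suc _) n≤k n≤l with b ∣? n
  ... | yes _ = digits′-fuel k l (n / b) (smaller n≤k) (smaller n≤l)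
    where
    smaller : ∀ {j} → n ≤ suc j → n / b ≤ j
    smaller n≤j = s≤s⁻¹ (<-≤-trans (m/n<m n b (nonTrivial⇒n>1 b)) n≤j)
  ... | no  _ = refl

  digits-∤ : ∀ n → ¬ b ∣ n → digits n ≡ n mod (b * b)
  digits-∤ zero    _ = refl
  digits-∤ (suc n) b∤n with b ∣? suc n
  ... | yes b∣n = contradiction b∣n b∤n
  ... | no  _   = refl

  digits′-* : ∀ k n → n ≤ k → digits′ (suc k) (n * b) ≡ digits n
  digits′-* k n n≤k with b ∣? (n * b)
  ... | yes _ = trans (cong (digits′ k) (m*n/n≡m n b)) (digits′-fuel k n n n≤k ≤-refl)
  ... | no ∤  = contradiction (n∣m*n n) ∤

  digits-* : ∀ n → digits (n * b) ≡ digits n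
  digits-* zero = refl
  digits-* n@(suc _) = trans
    (digits′-fuel (n * b) (suc (n * b)) (n * b) ≤-refl (n≤1+n _))
    (digits′-* (n * b) n (m≤m*n n b))

  -- If `b ∤ n`, then `b ∤ n + d * b` too, so both values are plain residues modulo `b * b`; their
  -- equality gives `b * b ∣ d * b`, hence `b ∣ d`.
  digits-step : ∀ n d → digits n ≡ digits (n + d * b) → ¬ b ∣ d → b ∣ n
  digits-step n d eq b∤d with b ∣? n
  ... | yes b∣n = b∣n
  ... | no  b∤n = contradiction (*-cancelʳ-∣ b (mod≡⇒∣ (b * b) n (d * b) eq′)) b∤d
    where
    b∤n+ : ¬ b ∣ n + d * b
    b∤n+ b∣ = b∤n (∣m+n∣m⇒∣n (subst (b ∣_) (+-comm n (d * b)) b∣) (n∣m*n d))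

    eq′ : n mod (b * b) ≡ (n + d * b) mod (b * b)
    eq′ = trans (sym (digits-∤ n b∤n)) (trans eq (digits-∤ (n + d * b) b∤n+))

  swap : ∀ q → b * (2 * q) ≡ 2 * (q * b)
  swap q = begin
    b * (2 * q)  ≡⟨ *-comm b (2 * q) ⟩
    2 * q * b    ≡⟨ *-assoc 2 q b ⟩
    2 * (q * b)  ∎
    where open ≡-Reasoning

  -- By `digits-step` every position of the window is a multiple of `b`, and two consecutive numbers
  -- cannot both be, as `b ≥ 2`.
  digits-short : ∀ q → ¬ b ∣ q → ∀ i m → Repeats digits i m (q * b) → m ≤ 1
  digits-short q b∤q i zero          rep = z≤n
  digits-short q b∤q i (suc zero)    rep = ≤-refl
  digits-short q b∤q i (suc (suc m)) rep =
    contradiction (∣1⇒≡1 (∣m+n∣m⇒∣n b∣i+1 b∣i)) (nonTrivial⇒≢1 {{nt}})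
    where
    b∣i : b ∣ i
    b∣i = digits-step i q (rep i ≤-refl (m<m+n i (s≤s z≤n))) b∤q

    b∣i+1 : b ∣ i + 1
    b∣i+1 = digits-step (i + 1) q (rep (i + 1) (m≤m+n i 1) (+-monoʳ-< i (s≤s (s≤s z≤n)))) b∤q

  -- `digits` read along the multiples of `b` is `digits` again, with distances divided by `b`. A
  -- window of length `m` contains at least `m / b` such multiples.
  digits-coarsen : ∀ q i m → Repeats digits i m (q * b) →
                   ∃ λ j → Repeats digits j (m / b) q
  digits-coarsen q i m rep with ceiling b i
  ... | j , i≤jb , jb<i+b = j , λ n j≤n n<j+m/b →
    trans (sym (digits-* n))
      (trans (rep (n * b) (≤-trans i≤jb (*-monoˡ-≤ b j≤n)) (inside n n<j+m/b))
        (trans (cong digits (sym (*-distribʳ-+ b n q))) (digits-* (n + q))))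
    where
    open ≤-Reasoning
    inside : ∀ n → n < j + m / b → n * b < i + m
    -- The bound is proved with `b` added on both sides: on the left this gives the next multiple of
    -- `b`, on the right it absorbs the rounding up of `i`.
    inside n n< = +-cancelˡ-< b _ _ (begin-strict
      suc n * b          ≤⟨ *-monoˡ-≤ b n< ⟩
      (j + m / b) * b    ≡⟨ *-distribʳ-+ b j (m / b) ⟩
      j * b + m / b * b  <⟨ +-mono-<-≤ jb<i+b (m/n*n≤m m b) ⟩
      i + b + m          ≡⟨ cong (_+ m) (+-comm i b) ⟩
      b + i + m          ≡⟨ +-assoc b i m ⟩
      b + (i + m)        ∎)

  -- If b ∤ q, the window consists of multiples of b only; if b ∣ q, the multiples
  -- of b in it, divided by b, form a repetition at distance q.
  digits-gap : ∀ q → Acc _<_ q → 0 < q → ∀ i m → Repeats digits i m (q * b) →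
               b * suc m ≤ 2 * (q * b)
  digits-gap q (acc rs) 0<q i m rep with b ∣? q
  ... | no b∤q = begin
    -- Here `m ≤ 1`, so `suc m ≤ 2`: this is the source of the factor 2 in the bound.
    b * suc m    ≤⟨ *-monoʳ-≤ b (s≤s (digits-short q b∤q i m rep)) ⟩
    b * 2        ≤⟨ *-monoʳ-≤ b (*-monoʳ-≤ 2 0<q) ⟩
    b * (2 * q)  ≡⟨ swap q ⟩
    2 * (q * b)  ∎
    where open ≤-Reasoning
  ... | yes (divides zero refl) = contradiction 0<q (λ ())
  ... | yes (divides p@(suc _) refl) with digits-coarsen (p * b) i m rep
  ... | j , rep′ = begin
    b * suc m              ≤⟨ *-monoʳ-≤ b suc-m≤ ⟩
    b * (suc (m / b) * b)  ≡⟨ *-assoc b (suc (m / b)) b ⟨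
    b * suc (m / b) * b    ≤⟨ *-monoˡ-≤ b (digits-gap p (rs (m<m*n p b (nonTrivial⇒n>1 b))) (s≤s z≤n) j (m / b) rep′) ⟩
    2 * (p * b) * b        ≡⟨ *-assoc 2 (p * b) b ⟩
    2 * (p * b * b)        ∎
    where
    open ≤-Reasoning
    -- The induction relies on `suc m` in the bound: `suc (m / b) * b` is at least `suc m`, whereas
    -- `m / b * b` can fall short of `m`.
    suc-m≤ : m < b + m / b * b
    suc-m≤ = begin-strict
      m                  ≡⟨ m≡m%n+[m/n]*n m b ⟩
      m % b + m / b * b  <⟨ +-monoˡ-< (m / b * b) (m%n<n m b) ⟩
      b + m / b * b      ∎

  -- The first component forces the distance between equal letters to be a multiple of `b`, the form
  -- `q * b` that `digits-gap` handles.
  word : InfWord (b * (b * b))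
  word n = combine (n mod b) (digits n)

  word-gap : ∀ i m d → 0 < m → 0 < d → Repeats word i m d → b * suc m ≤ 2 * d
  word-gap i m d 0<m 0<d rep
    with mod≡⇒∣ b i d (combine-injectiveˡ (i mod b) (digits i) ((i + d) mod b) (digits (i + d)) (rep i ≤-refl (m<m+n i 0<m)))
  ... | divides zero refl      = contradiction 0<d (λ ())
  ... | divides q@(suc _) refl = digits-gap q (<-wellFounded q) (s≤s z≤n) i m λ n i≤n n<i+m →
    combine-injectiveʳ (n mod b) (digits n) ((n + d) mod b) (digits (n + d)) (rep n i≤n n<i+m)

Sparse : {k : ℕ} → ℕ → InfWord k → Set
Sparse c w = ∀ i m d → 0 < m → 0 < d → Repeats w i m d → c * m < d

sparse-word : ∀ c → ∃ λ k → Σ (InfWord k) (Sparse c)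
sparse-word c = _ , word , λ i m d 0<m 0<d rep → begin-strict
  c * m          <⟨ *-mono-< (n<1+n c) (n<1+n m) ⟩
  suc c * suc m  ≤⟨ *-cancelˡ-≤ 2 (≤-trans (≤-reflexive (doubling c m)) (word-gap i m d 0<m 0<d rep)) ⟩
  d              ∎
  where
  -- The base is `2 * suc c`: its 2 cancels against that of `word-gap` and leaves
  -- `suc c * suc m ≤ d`.
  open Toeplitz (suc (suc (c + c)))
  open ≤-Reasoning
  doubling : ∀ c m → 2 * (suc c * suc m) ≡ suc (suc (c + c)) * suc m
  doubling = solve-∀

-- Factors of infinite words

module _ {k : ℕ} (w : InfWord k) where

  -- Recursion on the word lets an occurrence of a concatenation be cut by induction, without the
  -- index arithmetic of `Factor`.
  OccursAt : List (Fin k) → ℕ → Set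
  OccursAt []      i = ⊤
  OccursAt (a ∷ u) i = w i ≡ a × OccursAt u (suc i)

  lookup⇒occursAt : ∀ u i → (∀ j (p : j < length u) → w (i + j) ≡ lookup u (fromℕ< p)) → OccursAt u i
  lookup⇒occursAt []      i eq = tt
  lookup⇒occursAt (a ∷ u) i eq =
    trans (cong w (sym (+-identityʳ i))) (eq 0 (s≤s z≤n)) ,
    lookup⇒occursAt u (suc i) λ j p → trans (cong w (sym (+-suc i j))) (eq (suc j) (s≤s p))

  factor⇒occursAt : ∀ {u} → Factor u w → ∃ (OccursAt u)
  factor⇒occursAt {u} (i , eq) = i , lookup⇒occursAt u i eq

  occursAt⇒lookup : ∀ u i → OccursAt u i → ∀ j (p : j < length u) → w (i + j) ≡ lookup u (fromℕ< p)
  occursAt⇒lookup (a ∷ u) i (eq , at) zero    p = trans (cong w (+-identityʳ i)) eq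
  occursAt⇒lookup (a ∷ u) i (eq , at) (suc j) p =
    trans (cong w (+-suc i j)) (occursAt⇒lookup u (suc i) at j (s≤s⁻¹ p))

  occursAt-++⁻ : ∀ u {v} i → OccursAt (u ++ v) i → OccursAt u i × OccursAt v (i + length u)
  occursAt-++⁻ []          i at = tt , subst (OccursAt _) (sym (+-identityʳ i)) at
  occursAt-++⁻ (a ∷ u) {v} i (eq , at) with occursAt-++⁻ u (suc i) at
  ... | atᵤ , atᵥ = (eq , atᵤ) , subst (OccursAt v) (sym (+-suc i (length u))) atᵥ

  factor-++⁻ʳ : ∀ u {v} → Factor (u ++ v) w → Factor v w
  factor-++⁻ʳ u {v} fac with factor⇒occursAt fac
  ... | i , at = i + length u , occursAt⇒lookup v _ (proj₂ (occursAt-++⁻ u i at))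

  occursAt-repeats : ∀ u i d → OccursAt u i → OccursAt u (i + d) → Repeats w i (length u) d
  occursAt-repeats []      i d _ _ n i≤n n<i = contradiction (subst (n <_) (+-identityʳ i) n<i) (≤⇒≯ i≤n)
  occursAt-repeats (a ∷ u) i d (eq , at) (eq′ , at′) n i≤n n<i+m with m≤n⇒m<n∨m≡n i≤n
  ... | inj₂ refl = trans eq (sym eq′)
  ... | inj₁ i<n  = occursAt-repeats u (suc i) d at at′ n i<n (subst (n <_) (+-suc i (length u)) n<i+m)

-- Formulas in which each variable occurs twice in some fragment

occ-∷-≡ : ∀ x φ → occ x (x ∷ φ) ≡ suc (occ x φ)
occ-∷-≡ x φ = cong length (filter-accept (x ≟_) {xs = φ} refl)

occ-∷-≢ : ∀ {x y} φ → x ≢ y → occ x (y ∷ φ) ≡ occ x φ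
occ-∷-≢ {x} φ x≢y = cong length (filter-reject (x ≟_) {xs = φ} x≢y)

occ-++ : ∀ x φ χ → occ x (φ ++ χ) ≡ occ x φ + occ x χ
occ-++ x φ χ = trans (cong length (filter-++ (x ≟_) φ χ)) (length-++ (filter (x ≟_) φ))

∈⇒1≤occ : ∀ {x} φ → x ∈ φ → 1 ≤ occ x φ
∈⇒1≤occ {x} φ = filter-some (x ≟_)

1≤occ⇒∈ : ∀ x φ → 1 ≤ occ x φ → x ∈ φ
1≤occ⇒∈ x (y ∷ φ) 1≤ with x ≟ y
... | yes x≡y = here x≡y
... | no  x≢y = there (1≤occ⇒∈ x φ (subst (1 ≤_) (occ-∷-≢ φ x≢y) 1≤))

2≤occ⇒++ : ∀ x φ → 2 ≤ occ x φ → ∃₂ λ α β → ∃ λ γ → φ ≡ α ++ (x ∷ β) ++ x ∷ γ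
2≤occ⇒++ x (y ∷ φ) 2≤ with x ≟ y
... | no x≢y with 2≤occ⇒++ x φ (subst (2 ≤_) (occ-∷-≢ φ x≢y) 2≤)
...   | α , β , γ , refl = y ∷ α , β , γ , refl
2≤occ⇒++ x (.x ∷ φ) 2≤ | yes refl
  with ∈-∃++ (1≤occ⇒∈ x φ (s≤s⁻¹ (subst (2 ≤_) (occ-∷-≡ x φ) 2≤)))
...   | β , γ , refl = [] , β , γ , refl

length-apply-≤ : ∀ {k} (h : Morphism k) {m} φ → All (λ y → length (h y) ≤ m) φ →
                 length (apply h φ) ≤ length φ * m
length-apply-≤ h []      []          = z≤n
length-apply-≤ h (y ∷ φ) (y≤m ∷ φ≤m) =
  ≤-trans (≤-reflexive (length-++ (h y))) (+-mono-≤ y≤m (length-apply-≤ h φ φ≤m))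

≢[]⇒0<length : ∀ {A : Set} (u : List A) → u ≢ [] → 0 < length u
≢[]⇒0<length []      u≢[] = contradiction refl u≢[]
≢[]⇒0<length (_ ∷ _) _    = s≤s z≤n

-- The two copies of x in φ = α x β x γ are |h (x β)| apart.
twice-sparse : ∀ {k} {w : InfWord k} {c} → Sparse c w → (h : Morphism k) → NonErasing h →
               ∀ x φ → 2 ≤ occ x φ → All (λ y → length (h y) ≤ length (h x)) φ →
               length φ ≤ c → ¬ Factor (apply h φ) w
twice-sparse {w = w} {c} sparse h h≢[] x φ 2≤ longest φ≤c fac
  with 2≤occ⇒++ x φ 2≤
... | α , β , γ , refl
  rewrite concatMap-++ h α ((x ∷ β) ++ x ∷ γ) | concatMap-++ h (x ∷ β) (x ∷ γ)
  with factor⇒occursAt w fac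
-- Sparsity puts the copies more than `c * length (h x)` apart, but `x ∷ β` has at most `c` letters,
-- each with an image no longer than `h x`.
... | i , at = <-irrefl refl (begin-strict
    c * length (h x)          <⟨ sparse j (length (h x)) d 0<|hx| 0<d (occursAt-repeats w (h x) j d first second) ⟩
    d                         ≤⟨ length-apply-≤ h (x ∷ β) (++⁻ˡ (x ∷ β) (++⁻ʳ α longest)) ⟩
    length (x ∷ β) * length (h x)  ≤⟨ *-monoˡ-≤ (length (h x)) xβ≤c ⟩
    c * length (h x)          ∎)
  where
  open ≤-Reasoning
  j = i + length (apply h α)
  d = length (apply h (x ∷ β))

  at₁ : OccursAt w (apply h (x ∷ β) ++ apply h (x ∷ γ)) j
  at₁ = proj₂ (occursAt-++⁻ w (apply h α) i at)

  first : OccursAt w (h x) j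
  first = proj₁ (occursAt-++⁻ w (h x) j (proj₁ (occursAt-++⁻ w (apply h (x ∷ β)) j at₁)))

  second : OccursAt w (h x) (j + d)
  second = proj₁ (occursAt-++⁻ w (h x) (j + d) (proj₂ (occursAt-++⁻ w (apply h (x ∷ β)) j at₁)))

  0<|hx| : 0 < length (h x)
  0<|hx| = ≢[]⇒0<length (h x) (h≢[] x)

  0<d : 0 < d
  0<d = ≤-trans 0<|hx| (length-++-≤ˡ (h x))

  xβ≤c : length (x ∷ β) ≤ c
  xβ≤c = ≤-trans (length-++-≤ˡ (x ∷ β)) (≤-trans (length-++-≤ʳ ((x ∷ β) ++ x ∷ γ) {α}) φ≤c)

-- Both occurrences must lie in one fragment, since images of different fragments may be arbitrarily
-- far apart in the word.
Doubled : Formula → Set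
Doubled f = ∀ x → x ∈ concat f → Any (λ φ → 2 ≤ occ x φ) f

length≤length-concat : ∀ {φ : Word} {f} → φ ∈ f → length φ ≤ length (concat f)
length≤length-concat {φ} {_ ∷ f} (here refl) = length-++-≤ˡ φ
length≤length-concat {φ} {χ ∷ f} (there φ∈f) =
  ≤-trans (length≤length-concat φ∈f) (length-++-≤ʳ (concat f) {χ})

maximiser : ∀ {A : Set} (g : A → ℕ) {x} {xs} → x ∈ xs →
                   ∃ λ y → y ∈ xs × All (λ z → g z ≤ g y) xs
-- `argmax` may return its default, so the default is a known member of `xs`.
maximiser g {x} {xs} x∈xs with argmax-sel g x xs
... | inj₁ eq  = argmax g x xs , subst (_∈ xs) (sym eq) x∈xs , f[xs]≤f[argmax] x xs
... | inj₂ y∈  = argmax g x xs , y∈ , f[xs]≤f[argmax] x xs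

doubled⇒avoidable : ∀ {f x} → x ∈ concat f → Doubled f → Avoidable f
-- The word is fixed before `h` determines the fragment to be used, so the constant is the total
-- length, which bounds every fragment.
doubled⇒avoidable {f} x∈f doubled with sparse-word (length (concat f))
... | k , w , sparse = k , w , λ (h , h≢[] , occurs) →
  let y , y∈f , longest = maximiser (length ∘ h) x∈f
      φ , φ∈f , 2≤      = find (doubled y y∈f)
  in twice-sparse sparse h h≢[] y φ 2≤
       (All.tabulate λ z∈φ → All.lookup longest (∈-concat⁺′ z∈φ φ∈f))
       (length≤length-concat φ∈f) (All.lookup occurs φ∈f)

-- The same word works, because the image of `ψ` is a suffix of the image of `A ∷ ψ`.
avoidable-∷ : ∀ A {ψ f} → Avoidable (ψ ∷ []) → Avoidable ((A ∷ ψ) ∷ f)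
avoidable-∷ A {ψ} (k , w , avoids) = k , w , λ where
  (h , h≢[] , fac ∷ _) → avoids (h , h≢[] , factor-++⁻ʳ w (h A) fac ∷ [])

-- Splitting a single fragment

Twice : Word → Set
Twice φ = ∀ x → x ∈ φ → 2 ≤ occ x φ

occ-∷ʳ-≢ : ∀ {x y} φ → x ≢ y → occ x (φ ++ [ y ]) ≡ occ x φ
occ-∷ʳ-≢ {x} {y} φ x≢y = begin
  occ x (φ ++ [ y ])     ≡⟨ occ-++ x φ [ y ] ⟩
  occ x φ + occ x [ y ]  ≡⟨ cong (occ x φ +_) (occ-∷-≢ [] x≢y) ⟩
  occ x φ + 0            ≡⟨ +-identityʳ (occ x φ) ⟩
  occ x φ                ∎
  where open ≡-Reasoning

twice⇒doubled : ∀ {φ} → Twice φ → Doubled (φ ∷ [])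
twice⇒doubled {φ} twice x x∈ with ∈-++⁻ φ x∈
... | inj₁ x∈φ = here (twice x x∈φ)

-- Only copies of `A` are removed, and no variable of `ψ` is `A`.
inner-twice : ∀ {A ψ} → Twice (A ∷ ψ ++ [ A ]) → A ∉ ψ → Twice ψ
inner-twice {A} {ψ} twice A∉ψ x x∈ψ =
  subst (2 ≤_) (trans (occ-∷-≢ (ψ ++ [ A ]) x≢A) (occ-∷ʳ-≢ ψ x≢A)) (twice x (there (∈-++⁺ˡ x∈ψ)))
  where
  x≢A : x ≢ A
  x≢A refl = A∉ψ x∈ψ

-- A variable other than `B` keeps all its occurrences in `A ψ`, and one other than `A` keeps them
-- in `ψ B`. If `x = A = B`, the leading `A` and a copy in `ψ` make two.
split-doubled : ∀ {A ψ B} → Twice (A ∷ ψ ++ [ B ]) → (A ≡ B → A ∈ ψ) →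
                Doubled ((A ∷ ψ) ∷ (ψ ++ [ B ]) ∷ [])
split-doubled {A} {ψ} {B} twice A≡B⇒A∈ψ x x∈ = fragment (twice x x∈φ)
  where
  x∈φ : x ∈ A ∷ ψ ++ [ B ]
  x∈φ with ∈-++⁻ (A ∷ ψ) x∈
  ... | inj₁ x∈Aψ = ∈-++⁺ˡ x∈Aψ
  ... | inj₂ x∈′ with ∈-++⁻ (ψ ++ [ B ]) x∈′
  ...   | inj₁ x∈ψB = there x∈ψB

  fragment : 2 ≤ occ x (A ∷ ψ ++ [ B ]) → Any (λ χ → 2 ≤ occ x χ) ((A ∷ ψ) ∷ (ψ ++ [ B ]) ∷ [])
  fragment 2≤ with x ≟ A | x ≟ B
  ... | _        | no x≢B   = here (subst (2 ≤_) (occ-∷ʳ-≢ (A ∷ ψ) x≢B) 2≤)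
  ... | no x≢A   | _        = there (here (subst (2 ≤_) (occ-∷-≢ (ψ ++ [ B ]) x≢A) 2≤))
  ... | yes refl | yes refl =
    here (subst (2 ≤_) (sym (occ-∷-≡ x ψ)) (s≤s (∈⇒1≤occ ψ (A≡B⇒A∈ψ refl))))

split-avoidable : ∀ {A C ψ B} → Twice (A ∷ (C ∷ ψ) ++ [ B ]) →
                  Avoidable ((A ∷ C ∷ ψ) ∷ ((C ∷ ψ) ++ [ B ]) ∷ [])
split-avoidable {A} {C} {ψ} {B} twice with A ≟ B | _∈?_ _≟_ A (C ∷ ψ)
-- `A` occurs just once in each fragment, so the split formula is not `Doubled`; the inner word is,
-- and `C` witnesses that it has a variable.
... | yes refl | no A∉  = avoidable-∷ A (doubled⇒avoidable (here refl) (twice⇒doubled (inner-twice twice A∉)))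
... | yes _    | yes A∈ = doubled⇒avoidable (here refl) (split-doubled twice (λ _ → A∈))
... | no A≢B   | _      = doubled⇒avoidable (here refl) (split-doubled twice (λ A≡B → contradiction A≡B A≢B))

-- For `φ = A ψ B`, the count `length φ ∸ 1` in `splitAt` reduces to `length (ψ ++ [ B ])`.
take-init : ∀ (A : Var) ψ B → take (length (ψ ++ [ B ])) (A ∷ ψ ++ [ B ]) ≡ A ∷ ψ
take-init A []      B = refl
take-init A (C ∷ ψ) B = cong (A ∷_) (take-init C ψ B)

minimal⇒square : ∀ φ → IsOneFragmentFormula φ → MinimallyAvoidable (φ ∷ []) →
                 ∃ λ A → φ ≡ A ∷ A ∷ []
minimal⇒square []      (φ≢[] , _)  _             = contradiction refl φ≢[]
minimal⇒square (A ∷ φ) (_ , twice) (_ , minimal) with initLast φ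
... | [] = contradiction (subst (2 ≤_) (occ-∷-≡ A []) (twice A (here refl))) λ { (s≤s ()) }
... | (C ∷ ψ) ∷ʳ′ B = contradiction (split-avoidable twice)
  (subst (λ χ → Unavoidable (χ ∷ (C ∷ ψ ++ [ B ]) ∷ [])) (take-init A (C ∷ ψ) B) (minimal zero))
... | [] ∷ʳ′ B with A ≟ B
...   | yes refl = A , refl
...   | no A≢B   = contradiction (subst (2 ≤_) once (twice A (here refl))) λ { (s≤s ()) }
  where
  once : occ A (A ∷ B ∷ []) ≡ 1
  once = trans (occ-∷-≡ A [ B ]) (cong suc (occ-∷-≢ [] A≢B))

square-minimal : ∀ A → Twice (A ∷ A ∷ []) → MinimallyAvoidable ((A ∷ A ∷ []) ∷ [])
square-minimal A twice = doubled⇒avoidable (here refl) (twice⇒doubled twice) ,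
  -- Splitting gives `A.A`, which occurs in any infinite word once every variable is sent to its
  -- first letter.
  λ { zero (k , w , avoids) → avoids ((λ _ → [ w 0 ]) , (λ _ ()) , letter w ∷ letter w ∷ []) }
  where
  letter : ∀ {k} (w : InfWord k) → Factor [ w 0 ] w
  letter w = 0 , λ where
    zero    _        → refl
    (suc _) (s≤s ())

theorem8 : (φ : Word) → IsOneFragmentFormula φ →
    (MinimallyAvoidable (φ ∷ []) → ∃ λ A → φ ≡ A ∷ A ∷ []) ×
    ((∃ λ A → φ ≡ A ∷ A ∷ []) → MinimallyAvoidable (φ ∷ []))
theorem8 φ one@(_ , twice) = minimal⇒square φ one , λ where
  (A , refl) → square-minimal A twice
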